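{- Let $k\ge 2$ be a natural number and let $S$ be a $k$-automatic subset of $\mathbb{N}$. A necessary condition for $S$ to be an additive basis for $\mathbb{N}$ is that $1\in S$. If $S$ is not sparse, $\gcd(S)=1$, and $1\in S$, then $S$ is an additive basis for $\mathbb{N}$, and these conditions are necessary.
   Context: $\mathbb{N}$ denotes the set of natural numbers (including $0$). The canonical base-$k$ expansion of $n\in\mathbb{N}$ is the unique word over $\{0,1,\ldots,k-1\}$ representing $n$ in base $k$ without leading zeros. A set $S\subseteq\mathbb{N}$ is $k$-automatic if the language of canonical base-$k$ expansions of its elements is regular, i.e., accepted by a deterministic finite automaton. $S$ is an additive basis for $\mathbb{N}$ if there exists a constant $j$ such that every natural number can be written as a sum of at most $j$ members of $S$. Let $\pi_S(x)=\#\{n\le x : n\in S\}$. $S$ is sparse if there is an integer $d\ge 0$ with $\pi_S(x)=O((\log x)^d)$. $\gcd(S)$ is the greatest common divisor of all elements of $S$. -}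

module Defs where

open import Data.Digit using (Expansion; fromDigits; toDigits)
open import Data.Fin using (Fin; zero; suc; toℕ)
open import Data.Fin.Subset using (Subset; _∈_)
open import Data.Fin.Subset.Properties using (_∈?_)
open import Data.List using (List; []; _∷_; [_]; _++_; foldl; reverse; length; sum; filter; upTo)
open import Data.List.Properties using (unfold-reverse; reverse-involutive)
open import Data.List.Relation.Unary.All using (All)
open import Data.Nat using (ℕ; suc; _+_; _*_; _^_; _≤_)
open import Data.Nat.Divisibility using (_∣_)
open import Data.Nat.Logarithm using (⌊log₂_⌋)
open import Data.Product using (∃-syntax; _×_; _,_)
open import Data.Unit using (⊤; tt)
open import Function.Bundles using (_⇔_; module Equivalence)
open import Level using (0ℓ)
open import Relation.Binary.PropositionalEquality using (_≡_; _≢_; refl; sym; trans; cong; subst)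
open import Relation.Nullary.Decidable using (fromWitness; map′)
open import Relation.Unary using (Pred; Decidable)

record DFA (A : Set) : Set where
  field
    states : ℕ
    start  : Fin states
    δ      : Fin states → A → Fin states
    final  : Subset states

Accepts : ∀ {A} → DFA A → Pred (List A) 0ℓ
Accepts M w = foldl δ start w ∈ final
  where open DFA M

Regular : ∀ {A} → Pred (List A) 0ℓ → Set
Regular {A} L = ∃[ M ] (∀ (w : List A) → L w ⇔ Accepts M w)

-- Words are written most significant digit first, whereas the library's
-- fromDigits reads the least significant digit first.
value : ∀ {k} → Expansion k → ℕ
value w = fromDigits (reverse w)

NoLeadingZero : ∀ {k} → Expansion k → Set
NoLeadingZero []      = ⊤
NoLeadingZero (d ∷ _) = toℕ d ≢ 0

-- The canonical expansion of 0 is the empty word.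
CanonicalExpansion : ∀ {k} → ℕ → Expansion k → Set
CanonicalExpansion n w = NoLeadingZero w × value w ≡ n

canonicalLanguage : ∀ k → Pred ℕ 0ℓ → Pred (Expansion k) 0ℓ
canonicalLanguage k S w = ∃[ n ] (S n × CanonicalExpansion n w)

Automatic : ℕ → Pred ℕ 0ℓ → Set
Automatic k S = Regular (canonicalLanguage k S)

private
  fromDigits-++0 : ∀ {k} (ds : Expansion (suc k)) →
                   fromDigits (ds ++ [ zero ]) ≡ fromDigits ds
  fromDigits-++0 []           = refl
  fromDigits-++0 {k} (d ∷ ds) = cong (λ m → toℕ d + m * suc k) (fromDigits-++0 ds)

  strip : ∀ {k} (w : Expansion k) → ∃[ v ] CanonicalExpansion {k} (value w) v
  strip []           = [] , tt , refl
  strip (zero  ∷ w)  with strip w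
  ... | v , nz , eq  = v , nz , trans eq (sym (trans (cong fromDigits (unfold-reverse zero w))
                                                     (fromDigits-++0 (reverse w))))
  strip (suc d ∷ w)  = (suc d ∷ w) , (λ ()) , refl

  reverse-value : ∀ {k} (ds : Expansion k) → value (reverse ds) ≡ fromDigits ds
  reverse-value ds = cong fromDigits (reverse-involutive ds)

canonicalExpansion : ∀ {k} → 2 ≤ k → ∀ n → ∃[ w ] CanonicalExpansion {k} n w
canonicalExpansion {k} 2≤k n with toDigits k {fromWitness 2≤k} n
... | ds , eq with strip (reverse ds)
...   | v , nz , eq′ = v , nz , trans eq′ (trans (reverse-value ds) eq)

-- Membership in an automatic set is decided by running the automaton; this is
-- what makes the counting function π available without further hypotheses.
automatic⇒decidable : ∀ {k S} → 2 ≤ k → Automatic k S → Decidable S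
automatic⇒decidable {k} {S} 2≤k (M , L⇔M) n with canonicalExpansion 2≤k n
... | w , nz , eq = map′ sound complete (foldl δ start w ∈? final)
  where
  open DFA M
  open Equivalence (L⇔M w)

  sound : Accepts M w → S n
  sound acc with from acc
  ... | m , m∈S , _ , eq′ = subst S (trans (sym eq′) eq) m∈S

  complete : S n → Accepts M w
  complete n∈S = to (n , n∈S , nz , eq)

π : ∀ {S : Pred ℕ 0ℓ} → Decidable S → ℕ → ℕ
π S? x = length (filter S? (upTo (suc x)))

_=O_ : (ℕ → ℕ) → (ℕ → ℕ) → Set
f =O g = ∃[ C ] ∃[ x₀ ] (∀ x → x₀ ≤ x → f x ≤ C * g x)

-- For x ≥ 2, ⌊log₂ x⌋ and the real logarithm of x are within constant factors
-- of each other, so O((log x)^d) has the same meaning for both.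
Sparse : ∀ {S : Pred ℕ 0ℓ} → Decidable S → Set
Sparse S? = ∃[ d ] (π S? =O (λ x → ⌊log₂ x ⌋ ^ d))

-- Sums may be empty, so 0 is always a sum of at most j members.
AdditiveBasis : Pred ℕ 0ℓ → Set
AdditiveBasis S = ∃[ j ] (∀ n → ∃[ xs ] (length xs ≤ j × All S xs × sum xs ≡ n))

-- Greatest with respect to divisibility; in particular the gcd of ∅ and of {0} is 0.
IsGCD : Pred ℕ 0ℓ → ℕ → Set
IsGCD S g = (∀ n → S n → g ∣ n) × (∀ c → (∀ n → S n → c ∣ n) → c ∣ g)

{-# OPTIONS --safe #-}
-- Call a useful state of the automaton branching if it lies on two cycles that
-- leave it by different digits.  If there is none, an accepted word is
-- determined by polynomially many choices of where it passes from one strongly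
-- connected component to the next, so S is sparse.  If q is branching, it has
-- two loops u, v of equal length ℓ, and S contains the values of all words
-- x v w y with w ∈ {u, v}*.  Put b = k^ℓ.  Adding b ∸ 1 such values with n
-- blocks in w turns the two-valued block digits into arbitrary base-b digits,
-- giving an arithmetic progression of length b^n whose difference E does not
-- depend on n and whose first term is of order b^n.  Boundedly many
-- progressions, together with fewer than E copies of 1, reach every integer.
-- Conversely, sums of j members of a sparse set are too few to fill [0, x].
module Submission where

open import Defs
open import Data.Digit using (Expansion; fromDigits)
open import Data.Fin using (Fin; toℕ)
import Data.Fin as Fin
import Data.Fin.Properties as Fin
open import Data.Fin.Subset using (Subset; _∈_; ∣_∣; ⊤; _-_)
open import Data.Fin.Subset.Properties
  using (_∈?_; ∈⊤; ∣⊤∣≡n; x∈p⇒∣p-x∣<∣p∣; x∈p∧x≢y⇒x∈p-y)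
open import Data.List
  using (List; []; _∷_; [_]; _++_; foldl; length; reverse; take; drop; map; concatMap;
         cartesianProductWith; allFin; upTo; filter; lookup)
import Data.List.Membership.Propositional as List
open import Data.List.Membership.Propositional.Properties
  using (∈-map⁺; ∈-++⁺ˡ; ∈-++⁺ʳ; ∈-concatMap⁺; ∈-allFin; ∈-upTo⁺; ∈-upTo⁻; ∈-filter⁺; ∈-filter⁻;
         ∈-lookup; ∈-cartesianProductWith⁺)
open import Data.List.Properties
  using (foldl-++; length-++; length-take; length-drop; length-reverse; reverse-++; take++drop≡id;
         length-map; length-upTo; length-tabulate)
open import Data.List.Relation.Binary.Subset.Propositional using (_⊆_)
open import Data.List.Relation.Unary.All as All using (All; []; _∷_)
open import Data.List.Relation.Unary.AllPairs using (_∷_)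
open import Data.List.Relation.Unary.Any as Any using (here; there)
open import Data.List.Relation.Unary.Any.Properties using (lookup-index)
open import Data.List.Relation.Unary.Unique.Propositional using (Unique)
open import Data.List.Relation.Unary.Unique.Propositional.Properties using (upTo⁺; filter⁺)
open import Data.Nat
open import Data.Nat.Divisibility using (1∣_)
open import Data.Nat.DivMod
open import Data.Nat.Induction using (<-rec)
open import Data.Nat.ListAction using (sum)
open import Data.Nat.Logarithm using (⌊log₂_⌋; ⌊log₂⌋-mono-≤; ⌊log₂[2^n]⌋≡n)
open import Data.Nat.Properties
open import Data.Nat.Tactic.RingSolver using (solve-∀)
open import Data.Product using (∃-syntax; _×_; _,_)
open import Data.Sum using (inj₁; inj₂; [_,_]′)
open import Function.Bundles using (_⇔_; module Equivalence)
open import Level using (0ℓ)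
open import Relation.Binary using (tri<; tri≈; tri>)
open import Relation.Binary.PropositionalEquality hiding ([_])
open import Relation.Nullary using (Dec; ¬_; yes; no; contradiction)
open import Relation.Nullary.Decidable using (map′; _×-dec_; _⊎-dec_)
open import Relation.Unary using (Pred; Decidable)

-- Sums of arithmetic progressions

-- The number of summands is exact rather than an upper bound, so that counts add under `_⊕_` and
-- `affine` picks up the constant term once per summand.
data SumOf (P : Pred ℕ 0ℓ) : ℕ → ℕ → Set where
  []  : SumOf P 0 0
  _∷_ : ∀ {x j n} → P x → SumOf P j n → SumOf P (suc j) (x + n)

module _ {P : Pred ℕ 0ℓ} where

  infixr 5 _⊕_

  _⊕_ : ∀ {i j m n} → SumOf P i m → SumOf P j n → SumOf P (i + j) (m + n)
  []                              ⊕ t = t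
  _⊕_ {n = n} (_∷_ {x} {n = m} p s) t = subst (SumOf P _) (sym (+-assoc x m n)) (p ∷ (s ⊕ t))

  ones : P 1 → ∀ n → SumOf P n n
  ones p zero    = []
  ones p (suc n) = p ∷ ones p n

  toSummands : ∀ {j n} → SumOf P j n → ∃[ xs ] (length xs ≡ j × All P xs × sum xs ≡ n)
  toSummands []      = [] , refl , [] , refl
  toSummands (_∷_ {x} p s) with toSummands s
  ... | xs , len , ps , eq = x ∷ xs , cong suc len , p ∷ ps , cong (x +_) eq

affine : ∀ {P Q : Pred ℕ 0ℓ} {j n} α β → (∀ {x} → P x → Q (α * x + β)) →
         SumOf P j n → SumOf Q j (α * n + j * β)
affine α β f [] rewrite *-zeroʳ α = []
affine {Q = Q} α β f (_∷_ {x} {j} {n} p s) =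
  subst (SumOf Q (suc j)) (rearrange α β x j n) (f p ∷ affine α β f s)
  where
  rearrange : ∀ α β x j n → α * x + β + (α * n + j * β) ≡ α * (x + n) + suc j * β
  rearrange = solve-∀

n<b^n : ∀ {b} → 2 ≤ b → ∀ n → n < b ^ n
n<b^n     2≤b zero    = z<s
n<b^n {b} 2≤b (suc n) = begin-strict
  suc n       ≤⟨ n<b^n 2≤b n ⟩
  b ^ n       <⟨ m<m*n (b ^ n) b {{>-nonZero (m<n⇒0<n (n<b^n 2≤b n))}} 2≤b ⟩
  b ^ n * b   ≡⟨ *-comm (b ^ n) b ⟩
  b ^ suc n   ∎
  where open ≤-Reasoning

-- Scanning down from `m`, the first index with `f n ≤ N` works. It selects the scale at which a
-- given `N` is represented.
crossing : ∀ {N} (f : ℕ → ℕ) → f 0 ≤ N → ∀ m → N < f m → ∃[ n ] (f n ≤ N × N < f (suc n))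
crossing f lo zero    hi = contradiction hi (≤⇒≯ lo)
crossing {N} f lo (suc m) hi with N <? f m
... | yes N<fm = crossing f lo m N<fm
... | no  N≮fm = m , ≮⇒≥ N≮fm , hi

-- `h` is the number of summands in each term of a progression, and `T` bounds the ratio of its
-- first term `s n` to its length `b ^ n`. Both are independent of `n`.
module Progressions
  (S : Pred ℕ 0ℓ) (1∈S : S 1) (b h E T : ℕ) (2≤b : 2 ≤ b) {{E≢0 : NonZero E}}
  (s : ℕ → ℕ) (s-lower : ∀ n → b ^ n ≤ s n) (s-upper : ∀ n → s n ≤ T * b ^ n)
  (progression : ∀ n m → m < b ^ n → SumOf S h (s n + E * m))
  where

  open ≤-Reasoning

  private
    b^n≢0 : ∀ n → NonZero (b ^ n)
    b^n≢0 n = >-nonZero (m<n⇒0<n (n<b^n 2≤b n))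

    instance
      s≢0 : ∀ {n} → NonZero (s n)
      s≢0 {n} = >-nonZero (≤-trans (m<n⇒0<n (n<b^n 2≤b n)) (s-lower n))

  -- Progressions with a common difference add to a longer one. The index `m` is distributed
  -- greedily: each progression takes as much as its last index `pred (b ^ n)` allows and leaves the
  -- rest to the others.
  progressions : ∀ n q m → m ≤ q * pred (b ^ n) → SumOf S (q * h) (q * s n + E * m)
  progressions n zero    zero z≤n rewrite *-zeroʳ E = []
  progressions n (suc q) m    m≤  =
    subst (SumOf S (h + q * h)) eq
      (progression n m₁ m₁< ⊕ progressions n q m₂ (m≤n+o⇒m∸n≤o m (pred (b ^ n)) m≤))
    where
    m₁ = pred (b ^ n) ⊓ m
    m₂ = m ∸ pred (b ^ n)

    m₁< : m₁ < b ^ n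
    m₁< = m≤pred[n]⇒suc[m]≤n {{b^n≢0 n}} (m⊓n≤m (pred (b ^ n)) m)

    rearrange : ∀ a q E m₁ m₂ → a + E * m₁ + (q * a + E * m₂) ≡ suc q * a + E * (m₁ + m₂)
    rearrange = solve-∀

    eq : s n + E * m₁ + (q * s n + E * m₂) ≡ suc q * s n + E * m
    eq = trans (rearrange (s n) q E m₁ m₂)
               (cong (λ z → suc q * s n + E * z) (m⊓n+n∸m≡n (pred (b ^ n)) m))

  1≤T : 1 ≤ T
  1≤T = begin
    1       ≤⟨ s-lower 0 ⟩
    s 0     ≤⟨ s-upper 0 ⟩
    T * 1   ≡⟨ *-identityʳ T ⟩
    T       ∎

  -- In order: `h` summands for each progression, fewer than `E` ones to correct the residue modulo
  -- `E`, and the ones that write any number below `threshold 0`.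
  bound : ℕ
  bound = 2 * T * (T * b) * h + (E + 2 * T * s 1)

  -- From here on the quotient by `s (suc n)` is at least `2 * T`, which gives enough progressions
  -- to reach every remainder. The scale is `suc n` because a progression of length `b ^ 0` is a
  -- single point.
  threshold : ℕ → ℕ
  threshold n = 2 * T * s (suc n)

  n<threshold : ∀ n → n < threshold n
  n<threshold n = begin-strict
    n                  <⟨ n<1+n n ⟩
    suc n              <⟨ n<b^n 2≤b (suc n) ⟩
    b ^ suc n          ≤⟨ s-lower (suc n) ⟩
    s (suc n)          ≡⟨ *-identityˡ (s (suc n)) ⟨
    1 * s (suc n)      ≤⟨ *-monoˡ-≤ (s (suc n)) (≤-trans 1≤T (m≤n*m T 2)) ⟩
    threshold n        ∎

  b^n≤2pred : ∀ n → b ^ suc n ≤ 2 * pred (b ^ suc n)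
  b^n≤2pred n = begin
    b ^ suc n                  ≡⟨ suc-pred (b ^ suc n) {{b^n≢0 (suc n)}} ⟨
    1 + pred (b ^ suc n)       ≤⟨ +-monoˡ-≤ (pred (b ^ suc n)) 1≤pred ⟩
    pred (b ^ suc n) + pred (b ^ suc n)  ≡⟨ cong (pred (b ^ suc n) +_) (+-identityʳ (pred (b ^ suc n))) ⟨
    2 * pred (b ^ suc n)       ∎
    where
    1≤pred : 1 ≤ pred (b ^ suc n)
    1≤pred = suc[m]≤n⇒m≤pred[n] (≤-trans (s≤s (s≤s z≤n)) (n<b^n 2≤b (suc n)))

  -- Divide `N` by the first term `s (suc n)`. The quotient `q` is the number of progressions; the
  -- multiple of `E` in the remainder `r` comes from their common difference, and ones supply
  -- `r % E`.
  represent : ∀ N → ∃[ j ] (j ≤ bound × SumOf S j N)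
  represent N with N <? threshold 0
  ... | yes N<  = N , ≤-trans (<⇒≤ N<) (≤-trans (m≤n+m _ E) (m≤n+m _ (2 * T * (T * b) * h))) , ones 1∈S N
  ... | no  N≮ with crossing threshold (≮⇒≥ N≮) N (n<threshold N)
  ...   | n , lo , hi = q * h + r % E
                      , +-mono-≤ (*-monoˡ-≤ h (<⇒≤ q<)) (≤-trans (<⇒≤ (m%n<n r E)) (m≤m+n E _))
                      , subst (SumOf S _) eq (progressions (suc n) q (r / E) few ⊕ ones 1∈S (r % E))
    where
    q = N / s (suc n)
    r = N % s (suc n)

    -- `N` lies below the next threshold, and consecutive first terms differ by a factor of at most
    -- `T * b`, so the number of progressions is bounded independently of `N`.
    q< : q < 2 * T * (T * b)
    q< = m<n*o⇒m/o<n (begin-strict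
      N                                       <⟨ hi ⟩
      2 * T * s (2 + n)                       ≤⟨ *-monoʳ-≤ (2 * T) (s-upper (2 + n)) ⟩
      2 * T * (T * (b * b ^ suc n))           ≡⟨ rearrange T b (b ^ suc n) ⟩
      2 * T * (T * b) * b ^ suc n             ≤⟨ *-monoʳ-≤ (2 * T * (T * b)) (s-lower (suc n)) ⟩
      2 * T * (T * b) * s (suc n)             ∎)
      where
      rearrange : ∀ T b p → 2 * T * (T * (b * p)) ≡ 2 * T * (T * b) * p
      rearrange = solve-∀

    ≤q : 2 * T ≤ q
    ≤q = begin
      2 * T                            ≡⟨ m*n/n≡m (2 * T) (s (suc n)) ⟨
      2 * T * s (suc n) / s (suc n)    ≤⟨ /-monoˡ-≤ (s (suc n)) lo ⟩
      q                                ∎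

    few : r / E ≤ q * pred (b ^ suc n)
    few = begin
      r / E                         ≤⟨ m/n≤m r E ⟩
      r                             ≤⟨ <⇒≤ (m%n<n N (s (suc n))) ⟩
      s (suc n)                     ≤⟨ s-upper (suc n) ⟩
      T * b ^ suc n                 ≤⟨ *-monoʳ-≤ T (b^n≤2pred n) ⟩
      T * (2 * pred (b ^ suc n))    ≡⟨ rearrange T (pred (b ^ suc n)) ⟩
      2 * T * pred (b ^ suc n)      ≤⟨ *-monoˡ-≤ (pred (b ^ suc n)) ≤q ⟩
      q * pred (b ^ suc n)          ∎
      where
      rearrange : ∀ T p → T * (2 * p) ≡ 2 * T * p
      rearrange = solve-∀

    eq : q * s (suc n) + E * (r / E) + r % E ≡ N
    eq = trans (rearrange (q * s (suc n)) E (r / E) (r % E))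
               (trans (cong (_+ q * s (suc n)) (sym (m≡m%n+[m/n]*n r E)))
                      (sym (m≡m%n+[m/n]*n N (s (suc n)))))
      where
      rearrange : ∀ a E x y → a + E * x + y ≡ y + x * E + a
      rearrange = solve-∀

  additiveBasis : AdditiveBasis S
  additiveBasis = bound , λ N → decompose N (represent N)
    where
    decompose : ∀ N → ∃[ j ] (j ≤ bound × SumOf S j N) →
                ∃[ xs ] (length xs ≤ bound × All S xs × sum xs ≡ N)
    decompose N (j , j≤ , sm) with toSummands sm
    ... | xs , refl , ps , eq = xs , j≤ , ps , eq

-- Sums of numbers written with two digits

-- In the application a digit is a block: `c` and `c + D` are the values of the loops `u` and `v`.
data TwoDigit (b c D : ℕ) : ℕ → ℕ → Set where
  empty : TwoDigit b c D 0 0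
  low   : ∀ {n z} → TwoDigit b c D n z → TwoDigit b c D (suc n) (b * z + c)
  high  : ∀ {n z} → TwoDigit b c D n z → TwoDigit b c D (suc n) (b * z + (c + D))

repdigit : ℕ → ℕ → ℕ → ℕ
repdigit b c zero    = 0
repdigit b c (suc n) = b * repdigit b c n + c

repdigit< : ∀ {b c} → c < b → ∀ n → repdigit b c n < b ^ n
repdigit<         c<b zero    = z<s
repdigit< {b} {c} c<b (suc n) = begin-strict
  b * repdigit b c n + c        <⟨ +-monoʳ-< (b * repdigit b c n) c<b ⟩
  b * repdigit b c n + b        ≡⟨ +-comm (b * repdigit b c n) b ⟩
  b + b * repdigit b c n        ≡⟨ *-suc b (repdigit b c n) ⟨
  b * suc (repdigit b c n)      ≤⟨ *-monoʳ-≤ b (repdigit< c<b n) ⟩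
  b ^ suc n                     ∎
  where open ≤-Reasoning

module _ {b c D : ℕ} where

  -- Give the high digit to `d` of the `j` summands and the low digit to the others; the last digits
  -- then add up to `j * c + d * D`.
  appendDigits : ∀ {n j m} d → d ≤ j → SumOf (TwoDigit b c D n) j m →
                 SumOf (TwoDigit b c D (suc n)) j (b * m + j * c + d * D)
  appendDigits zero z≤n [] rewrite *-zeroʳ b = []
  appendDigits {n} zero z≤n (_∷_ {x} {j} {m} p s) =
    subst (SumOf _ (suc j)) (rearrange b c D x j m) (low p ∷ appendDigits zero z≤n s)
    where
    rearrange : ∀ b c D x j m → b * x + c + (b * m + j * c + 0 * D) ≡
                                b * (x + m) + suc j * c + 0 * D
    rearrange = solve-∀
  appendDigits {n} (suc d) (s≤s d≤j) (_∷_ {x} {j} {m} p s) =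
    subst (SumOf _ (suc j)) (rearrange b c D x j m d) (high p ∷ appendDigits d d≤j s)
    where
    rearrange : ∀ b c D x j m d → b * x + (c + D) + (b * m + j * c + d * D) ≡
                                  b * (x + m) + suc j * c + suc d * D
    rearrange = solve-∀

-- A base-(1 + h) digit is a sum of h zeros and ones, so h two-digit numbers
-- realise every m with n digits in base 1 + h.
twoDigitSums : ∀ {h c D} n m → m < suc h ^ n →
               SumOf (TwoDigit (suc h) c D n) h (D * m + h * repdigit (suc h) c n)
twoDigitSums {h} {c} {D} zero zero _ =
  subst (SumOf _ h) (sym (cong₂ _+_ (*-zeroʳ D) (*-zeroʳ h))) (zeros h)
  where
  zeros : ∀ j → SumOf (TwoDigit (suc h) c D 0) j 0
  zeros zero    = []
  zeros (suc j) = empty ∷ zeros j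
twoDigitSums zero (suc m) (s≤s ())
twoDigitSums {h} {c} {D} (suc n) m m< =
  subst (SumOf _ h) eq
    (appendDigits (m % b) (m<1+n⇒m≤n (m%n<n m b)) (twoDigitSums n (m / b) m/b<))
  where
  b = suc h
  m/b< : m / b < b ^ n
  m/b< = m<n*o⇒m/o<n (subst (m <_) (*-comm b (b ^ n)) m<)

  rearrange : ∀ b h c D g q r → b * (D * q + h * g) + h * c + r * D ≡ D * (r + q * b) + h * (b * g + c)
  rearrange = solve-∀

  eq : b * (D * (m / b) + h * repdigit b c n) + h * c + m % b * D ≡ D * m + h * repdigit b c (suc n)
  eq = trans (rearrange b h c D (repdigit b c n) (m / b) (m % b))
             (cong (λ z → D * z + h * repdigit b c (suc n)) (sym (m≡m%n+[m/n]*n m b)))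

-- In the application x and y are the values of a fixed prefix and suffix, and β
-- is k to the length of the suffix.
module TwoDigitFamily
  (S : Pred ℕ 0ℓ) (1∈S : S 1) (h c D β x y : ℕ) (1≤h : 1 ≤ h)
  {{D≢0 : NonZero D}} {{β≢0 : NonZero β}} {{x≢0 : NonZero x}} (c<b : c < suc h)
  (member : ∀ n z → TwoDigit (suc h) c D n z → S ((x * suc h ^ n + z) * β + y))
  where

  private
    b = suc h

    -- This is the member whose `n` blocks all have the low value `c`. The progression starts at `h`
    -- times it, the case `m = 0` of `twoDigitSums`.
    offset : ℕ → ℕ
    offset n = (x * b ^ n + repdigit b c n) * β + y

    s : ℕ → ℕ
    s n = h * offset n

    T : ℕ
    T = h * ((x + 1) * β + y)

    instance
      h≢0 : NonZero h
      h≢0 = >-nonZero 1≤h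

      D*β≢0 : NonZero (D * β)
      D*β≢0 = m*n≢0 D β

    open ≤-Reasoning

    s-lower : ∀ n → b ^ n ≤ s n
    s-lower n = begin
      b ^ n                                      ≤⟨ m≤n*m (b ^ n) x ⟩
      x * b ^ n                                  ≤⟨ m≤m+n _ (repdigit b c n) ⟩
      x * b ^ n + repdigit b c n                 ≤⟨ m≤m*n _ β ⟩
      (x * b ^ n + repdigit b c n) * β           ≤⟨ m≤m+n _ y ⟩
      offset n                                   ≤⟨ m≤n*m _ h ⟩
      s n                                        ∎

    s-upper : ∀ n → s n ≤ T * b ^ n
    s-upper n = begin
      h * ((x * b ^ n + repdigit b c n) * β + y)
        ≤⟨ *-monoʳ-≤ h (+-mono-≤ (*-monoˡ-≤ β (+-monoʳ-≤ (x * b ^ n) (<⇒≤ (repdigit< c<b n))))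
                                  (m≤m*n y (b ^ n) {{m^n≢0 b n}})) ⟩
      h * ((x * b ^ n + b ^ n) * β + y * b ^ n)  ≡⟨ rearrange h x (b ^ n) β y ⟩
      T * b ^ n                                  ∎
      where
      rearrange : ∀ h x p β y → h * ((x * p + p) * β + y * p) ≡ h * ((x + 1) * β + y) * p
      rearrange = solve-∀

    progression : ∀ n m → m < b ^ n → SumOf S h (s n + D * β * m)
    progression n m m< =
      subst (SumOf S h) (rearrange β D m h (repdigit b c n) x (b ^ n) y)
        (affine β (x * b ^ n * β + y)
          (λ {z} t → subst S (expand x (b ^ n) z β y) (member n z t))
          (twoDigitSums n m m<))
      where
      expand : ∀ x p z β y → (x * p + z) * β + y ≡ β * z + (x * p * β + y)
      expand = solve-∀
      rearrange : ∀ β D m h g x p y → β * (D * m + h * g) + h * (x * p * β + y) ≡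
                                      h * ((x * p + g) * β + y) + D * β * m
      rearrange = solve-∀

  open Progressions S 1∈S b h (D * β) T (s≤s 1≤h) s s-lower s-upper progression public
    using (additiveBasis)

-- Words and automata

module _ {k : ℕ} where

  fromDigits-++ : ∀ (u v : Expansion k) → fromDigits (u ++ v) ≡ fromDigits v * k ^ length u + fromDigits u
  fromDigits-++ []      v = sym (trans (+-identityʳ _) (*-identityʳ _))
  fromDigits-++ (d ∷ u) v = trans (cong (λ z → toℕ d + z * k) (fromDigits-++ u v))
                                  (rearrange (toℕ d) (fromDigits v) (fromDigits u) (k ^ length u) k)
    where
    rearrange : ∀ d v u p k → d + (v * p + u) * k ≡ v * (k * p) + (d + u * k)
    rearrange = solve-∀

  value-++ : ∀ (u v : Expansion k) → value (u ++ v) ≡ value u * k ^ length v + value v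
  value-++ u v = trans (cong fromDigits (reverse-++ u v))
                (trans (fromDigits-++ (reverse v) (reverse u))
                       (cong (λ ℓ → value u * k ^ ℓ + value v) (length-reverse v)))

  value-∷ : ∀ d (w : Expansion k) → value (d ∷ w) ≡ toℕ d * k ^ length w + value w
  value-∷ d w = trans (value-++ [ d ] w)
                      (cong (λ z → z * k ^ length w + value w) (+-identityʳ (toℕ d)))

  value< : ∀ (w : Expansion k) → value w < k ^ length w
  value< []      = z<s
  value< (d ∷ w) = begin-strict
    value (d ∷ w)                       ≡⟨ value-∷ d w ⟩
    toℕ d * k ^ length w + value w      <⟨ +-monoʳ-< (toℕ d * k ^ length w) (value< w) ⟩
    toℕ d * k ^ length w + k ^ length w ≡⟨ +-comm _ (k ^ length w) ⟩
    suc (toℕ d) * k ^ length w          ≤⟨ *-monoˡ-≤ (k ^ length w) (Fin.toℕ<n d) ⟩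
    k ^ length (d ∷ w)                  ∎
    where open ≤-Reasoning

  value-∷-< : ∀ {d e} (u v : Expansion k) → d Fin.< e → length u ≡ length v → value (d ∷ u) < value (e ∷ v)
  value-∷-< {d} {e} u v d<e len = begin-strict
    value (d ∷ u)                       ≡⟨ value-∷ d u ⟩
    toℕ d * k ^ length u + value u      <⟨ +-monoʳ-< (toℕ d * k ^ length u) (value< u) ⟩
    toℕ d * k ^ length u + k ^ length u ≡⟨ +-comm _ (k ^ length u) ⟩
    suc (toℕ d) * k ^ length u          ≤⟨ *-monoˡ-≤ (k ^ length u) d<e ⟩
    toℕ e * k ^ length u                ≡⟨ cong (λ ℓ → toℕ e * k ^ ℓ) len ⟩
    toℕ e * k ^ length v                ≤⟨ m≤m+n _ (value v) ⟩
    toℕ e * k ^ length v + value v      ≡⟨ value-∷ e v ⟨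
    value (e ∷ v)                       ∎
    where open ≤-Reasoning

module Automaton {k : ℕ} (M : DFA (Fin k)) where

  open DFA M public

  State : Set
  State = Fin states

  run : State → Expansion k → State
  run = foldl δ

  run-++ : ∀ q u v → run q (u ++ v) ≡ run (run q u) v
  run-++ = foldl-++ δ

  Reach : State → State → Set
  Reach p q = ∃[ w ] (run p w ≡ q)

  reach-trans : ∀ {p q r} → Reach p q → Reach q r → Reach p r
  reach-trans {p} (u , refl) (v , refl) = u ++ v , run-++ p u v

  -- By the pigeonhole principle two prefixes of `w` lead to the same state, and the segment between
  -- them can be cut out.
  shorten : ∀ p w → states < length w → ∃[ v ] (length v < length w × run p v ≡ run p w)
  shorten p w long with Fin.pigeonhole long (λ i → run p (take (toℕ i) w))
  ... | i , j , i<j , eq = take (toℕ i) w ++ drop (toℕ j) w , shorter , same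
    where
    shorter : length (take (toℕ i) w ++ drop (toℕ j) w) < length w
    shorter = begin-strict
      length (take (toℕ i) w ++ drop (toℕ j) w)        ≡⟨ length-++ (take (toℕ i) w) ⟩
      length (take (toℕ i) w) + length (drop (toℕ j) w) ≡⟨ cong₂ _+_ (length-take (toℕ i) w) (length-drop (toℕ j) w) ⟩
      toℕ i ⊓ length w + (length w ∸ toℕ j)            ≤⟨ +-monoˡ-≤ _ (m⊓n≤m (toℕ i) (length w)) ⟩
      toℕ i + (length w ∸ toℕ j)                       <⟨ +-monoˡ-< (length w ∸ toℕ j) i<j ⟩
      toℕ j + (length w ∸ toℕ j)                       ≡⟨ m+[n∸m]≡n (<⇒≤ (Fin.toℕ<n j)) ⟩
      length w                                         ∎
      where open ≤-Reasoning

    same : run p (take (toℕ i) w ++ drop (toℕ j) w) ≡ run p w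
    same = begin
      run p (take (toℕ i) w ++ drop (toℕ j) w)     ≡⟨ run-++ p (take (toℕ i) w) _ ⟩
      run (run p (take (toℕ i) w)) (drop (toℕ j) w) ≡⟨ cong (λ q → run q (drop (toℕ j) w)) eq ⟩
      run (run p (take (toℕ j) w)) (drop (toℕ j) w) ≡⟨ run-++ p (take (toℕ j) w) _ ⟨
      run p (take (toℕ j) w ++ drop (toℕ j) w)     ≡⟨ cong (run p) (take++drop≡id (toℕ j) w) ⟩
      run p w                                      ∎
      where open ≡-Reasoning

  -- Reachability by words of bounded length is a finite search. Since `states` is a sufficient
  -- bound, reachability itself is decidable.
  ShortReach : ℕ → State → State → Set
  ShortReach n p q = ∃[ w ] (length w ≤ n × run p w ≡ q)

  reach⇒short : ∀ {p q} → Reach p q → ShortReach states p q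
  reach⇒short {p} (w , refl) = <-rec Goal step (length w) w refl
    where
    Goal : ℕ → Set
    Goal n = ∀ w → length w ≡ n → ShortReach states p (run p w)

    step : ∀ n → (∀ {m} → m < n → Goal m) → Goal n
    step n rec w refl with length w ≤? states
    ... | yes short = w , short , refl
    ... | no  long  with shorten p w (≰⇒> long)
    ...   | v , v<w , same with rec v<w v refl
    ...     | u , short , eq = u , short , trans eq same

  shortReach? : ∀ n p q → Dec (ShortReach n p q)
  shortReach? zero    p q = map′ (λ eq → [] , z≤n , eq) (λ { ([] , _ , eq) → eq }) (p Fin.≟ q)
  shortReach? (suc n) p q =
    map′ [ (λ eq → [] , z≤n , eq) , (λ { (a , w , short , eq) → a ∷ w , s≤s short , eq }) ]′
         (λ { ([] , _ , eq) → inj₁ eq ; (a ∷ w , s≤s short , eq) → inj₂ (a , w , short , eq) })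
         (p Fin.≟ q ⊎-dec Fin.any? (λ a → shortReach? n (δ p a) q))

  reach? : ∀ p q → Dec (Reach p q)
  reach? p q = map′ (λ { (w , _ , eq) → w , eq }) reach⇒short (shortReach? states p q)

  Coaccessible : State → Set
  Coaccessible q = ∃[ r ] (r ∈ final × Reach q r)

  Branching : Set
  Branching = ∃[ q ] (Reach start q × Coaccessible q ×
              ∃[ a ] ∃[ b ] (a Fin.< b × Reach (δ q a) q × Reach (δ q b) q))

  -- This decision makes the split between the basis case and the sparse case constructive.
  branching? : Dec Branching
  branching? = Fin.any? λ q →
    reach? start q ×-dec
    Fin.any? (λ r → r ∈? final ×-dec reach? q r) ×-dec
    Fin.any? λ a → Fin.any? λ b → (a Fin.<? b) ×-dec reach? (δ q a) q ×-dec reach? (δ q b) q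

  -- Loops a u and b v at q need not have equal lengths, but a u b v and b v a u do.
  branching⇒loops : Branching →
    ∃[ q ] ∃[ x ] ∃[ y ] ∃[ u ] ∃[ v ] (run start x ≡ q × run q y ∈ final × run q u ≡ q × run q v ≡ q ×
      length u ≡ length v × 1 ≤ length u × value u < value v)
  branching⇒loops (q , (x , x≡) , (r , r∈ , y , refl) , a , b , a<b , (u , u≡) , (v , v≡)) =
    q , x , y , (a ∷ u) ++ (b ∷ v) , (b ∷ v) ++ (a ∷ u) , x≡ , r∈ ,
    trans (run-++ q (a ∷ u) (b ∷ v)) (trans (cong (λ p → run p (b ∷ v)) u≡) v≡) ,
    trans (run-++ q (b ∷ v) (a ∷ u)) (trans (cong (λ p → run p (a ∷ u)) v≡) u≡) ,
    cong suc len , s≤s z≤n , value-∷-< (u ++ b ∷ v) (v ++ a ∷ u) a<b len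
    where
    len : length (u ++ b ∷ v) ≡ length (v ++ a ∷ u)
    len rewrite length-++ u {b ∷ v} | length-++ v {a ∷ u} | +-suc (length u) (length v)
              | +-suc (length v) (length u) = cong suc (+-comm (length u) (length v))

-- From a branching state to an additive basis

module _ {k : ℕ} (2≤k : 2 ≤ k) {S : Pred ℕ 0ℓ} (1∈S : S 1) (M : DFA (Fin k))
  (L⇔M : ∀ w → canonicalLanguage k S w ⇔ Accepts M w) where

  open Automaton M

  -- Acceptance already makes `w` a canonical expansion of some member, and that member is its
  -- value.
  accepted⇒member : ∀ w → run start w ∈ final → S (value w)
  accepted⇒member w acc with Equivalence.from (L⇔M w) acc
  ... | n , n∈S , _ , eq = subst S (sym eq) n∈S

  branching⇒basis : Branching → AdditiveBasis S
  branching⇒basis br with branching⇒loops br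
  ... | q , x , y , u , v , x≡ , y∈ , u≡ , v≡ , len , 1≤ℓ , u<v =
    -- The prefix is `x ++ v` and not `x`, whose value may be 0. As `value v` exceeds `value u`, the
    -- extra loop makes the prefix positive, and the members grow at least like `b ^ n`.
    TwoDigitFamily.additiveBasis S 1∈S h (value u) D (k ^ length y) (value (x ++ v)) (value y)
      1≤h {{>-nonZero (m<n⇒0<n∸m u<v)}} {{m^n≢0 k (length y)}} {{>-nonZero 0<xv}} u<b member
    where
    instance
      k≢0 : NonZero k
      k≢0 = >-nonZero (≤-trans (s≤s z≤n) 2≤k)

    ℓ h D : ℕ
    ℓ = length u
    h = pred (k ^ ℓ)
    D = value v ∸ value u

    b≡ : suc h ≡ k ^ ℓ
    b≡ = suc-pred (k ^ ℓ) {{m^n≢0 k ℓ}}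

    1≤h : 1 ≤ h
    1≤h = suc[m]≤n⇒m≤pred[n] (≤-trans (s≤s 1≤ℓ) (n<b^n 2≤k ℓ))

    u<b : value u < suc h
    u<b = subst (value u <_) (sym b≡) (value< u)

    0<xv : 0 < value (x ++ v)
    0<xv = ≤-trans (m<n⇒0<n u<v) (≤-trans (m≤n+m (value v) _) (≤-reflexive (sym (value-++ x v))))

    loop : ∀ w w′ → run q w ≡ q → run q w′ ≡ q → run q (w ++ w′) ≡ q
    loop w w′ e e′ = trans (run-++ q w w′) (trans (cong (λ p → run p w′) e) e′)

    -- The length is recorded only through its power of `k`, the form in which it enters `value-++`.
    Word : ℕ → ℕ → Set
    Word n z = ∃[ w ] (run q w ≡ q × value w ≡ z × k ^ length w ≡ suc h ^ n)

    snoc : ∀ {n z} t → run q t ≡ q → length t ≡ ℓ → Word n z → Word (suc n) (suc h * z + value t)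
    snoc {n} {z} t t≡ len (w , w≡ , refl , size) =
      w ++ t , loop w t w≡ t≡ ,
      trans (value-++ w t) (cong (_+ value t) (trans (cong (value w *_) k^t) (*-comm (value w) (suc h)))) ,
      (begin
        k ^ length (w ++ t)         ≡⟨ cong (k ^_) (trans (length-++ w) (+-comm (length w) (length t))) ⟩
        k ^ (length t + length w)   ≡⟨ ^-distribˡ-+-* k (length t) (length w) ⟩
        k ^ length t * k ^ length w ≡⟨ cong₂ _*_ k^t size ⟩
        suc h ^ suc n               ∎)
      where
      open ≡-Reasoning
      k^t : k ^ length t ≡ suc h
      k^t = trans (cong (k ^_) len) (sym b≡)

    word : ∀ {n z} → TwoDigit (suc h) (value u) D n z → Word n z
    word empty    = [] , refl , refl , refl
    word (low {n} t) = snoc {n} u u≡ refl (word t)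
    word (high {n} {z} t) = subst (λ c → Word (suc n) (suc h * z + c)) (sym (m+[n∸m]≡n (<⇒≤ u<v)))
                        (snoc {n} v v≡ (sym len) (word t))

    member : ∀ n z → TwoDigit (suc h) (value u) D n z →
             S ((value (x ++ v) * suc h ^ n + z) * k ^ length y + value y)
    member n z t with word t
    ... | w , w≡ , refl , size = subst S eq (accepted⇒member (((x ++ v) ++ w) ++ y) (subst (_∈ final) (sym end) y∈))
      where
      end : run start (((x ++ v) ++ w) ++ y) ≡ run q y
      end = begin
        run start (((x ++ v) ++ w) ++ y)       ≡⟨ run-++ start ((x ++ v) ++ w) y ⟩
        run (run start ((x ++ v) ++ w)) y      ≡⟨ cong (λ p → run p y) (run-++ start (x ++ v) w) ⟩
        run (run (run start (x ++ v)) w) y     ≡⟨ cong (λ p → run (run p w) y) (run-++ start x v) ⟩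
        run (run (run (run start x) v) w) y    ≡⟨ cong (λ p → run (run (run p v) w) y) x≡ ⟩
        run (run (run q v) w) y                ≡⟨ cong (λ p → run (run p w) y) v≡ ⟩
        run (run q w) y                        ≡⟨ cong (λ p → run p y) w≡ ⟩
        run q y                                ∎
        where open ≡-Reasoning

      eq : value (((x ++ v) ++ w) ++ y) ≡ (value (x ++ v) * suc h ^ n + value w) * k ^ length y + value y
      eq = trans (value-++ ((x ++ v) ++ w) y)
                 (cong (λ c → c * k ^ length y + value y)
                   (trans (value-++ (x ++ v) w) (cong (λ p → value (x ++ v) * p + value w) size)))

-- Sparseness

module _ {A : Set} where

  lookup-injective : ∀ {xs : List A} → Unique xs → ∀ {i j} → lookup xs i ≡ lookup xs j → i ≡ j
  lookup-injective (x∉ ∷ uniq) {Fin.zero}  {Fin.zero}  _  = refl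
  lookup-injective (x∉ ∷ uniq) {Fin.zero}  {Fin.suc j} eq = contradiction eq (All.lookup x∉ (∈-lookup j))
  lookup-injective (x∉ ∷ uniq) {Fin.suc i} {Fin.zero}  eq = contradiction (sym eq) (All.lookup x∉ (∈-lookup i))
  lookup-injective (x∉ ∷ uniq) {Fin.suc i} {Fin.suc j} eq = cong Fin.suc (lookup-injective uniq eq)

  -- Sending each entry to its position in `ys` is injective, because distinct positions of `xs`
  -- hold distinct entries.
  Unique-⊆⇒length≤ : ∀ {xs ys : List A} → Unique xs → xs ⊆ ys → length xs ≤ length ys
  Unique-⊆⇒length≤ {xs} {ys} uniq xs⊆ys = Fin.injective⇒≤ {f = position} position-injective
    where
    position : Fin (length xs) → Fin (length ys)
    position i = Any.index (xs⊆ys (∈-lookup {xs = xs} i))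

    position-injective : ∀ {i j} → position i ≡ position j → i ≡ j
    position-injective {i} {j} eq = lookup-injective uniq
      (trans (lookup-index (xs⊆ys (∈-lookup i)))
      (trans (cong (lookup ys) eq) (sym (lookup-index (xs⊆ys (∈-lookup j))))))

  length-concatMap-≤ : ∀ {B : Set} (f : B → List A) c xs → (∀ {x} → x List.∈ xs → length (f x) ≤ c) →
                       length (concatMap f xs) ≤ length xs * c
  length-concatMap-≤ f c []       f≤ = z≤n
  length-concatMap-≤ f c (x ∷ xs) f≤ =
    ≤-trans (≤-reflexive (length-++ (f x)))
            (+-mono-≤ (f≤ (here refl)) (length-concatMap-≤ f c xs (λ x∈ → f≤ (there x∈))))

length-cartesianProductWith : ∀ {A B C : Set} (f : A → B → C) xs ys →
                              length (cartesianProductWith f xs ys) ≡ length xs * length ys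
length-cartesianProductWith f []       ys = refl
length-cartesianProductWith f (x ∷ xs) ys =
  trans (length-++ (map (f x) ys)) (cong₂ _+_ (length-map (f x) ys) (length-cartesianProductWith f xs ys))

^-distribʳ-* : ∀ n x y → (x * y) ^ n ≡ x ^ n * y ^ n
^-distribʳ-* zero    x y = refl
^-distribʳ-* (suc n) x y = trans (cong (x * y *_) (^-distribʳ-* n x y)) (rearrange x y (x ^ n) (y ^ n))
  where
  rearrange : ∀ x y a b → x * y * (a * b) ≡ x * a * (y * b)
  rearrange = solve-∀

-- Polynomially many accepted words without branching

module Covering {k : ℕ} (M : DFA (Fin k)) where

  open Automaton M

  Cyclic : State → Fin k → Set
  Cyclic q a = Reach (δ q a) q

  -- The witness inside the decision serves as the cyclic digit; at useful states of an unbranched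
  -- automaton `cyclic-unique` makes this choice unambiguous.
  ifAny : {P : Pred (Fin k) 0ℓ} → Dec (∃[ a ] P a) → (Fin k → List (Expansion k)) → List (Expansion k)
  ifAny (yes (a , _)) f = f a
  ifAny (no _)        f = []

  -- When no state branches, at most one digit keeps an accepting path inside
  -- the strongly connected component of its current state; s bounds the number
  -- of states reachable from q, which drops on leaving the component.
  cover : ℕ → ℕ → State → List (Expansion k)
  cover zero    n       q = []
  cover (suc s) zero    q = [ [] ]
  cover (suc s) (suc n) q =
    ifAny (Fin.any? (λ a → reach? (δ q a) q)) (λ a → map (a ∷_) (cover (suc s) n (δ q a))) ++
    concatMap (λ a → map (a ∷_) (cover s n (δ q a))) (allFin k)

  ifAny-length : ∀ {P c} (d : Dec (∃[ a ] P a)) f → (∀ a → length (f a) ≤ c) → length (ifAny {P} d f) ≤ c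
  ifAny-length (yes (a , _)) f f≤ = f≤ a
  ifAny-length (no _)        f f≤ = z≤n

  -- With `X = 1 + k * n` the recursion adds `X ^ (1 + s)` and `k * X ^ s`. Their sum
  -- `(X + k) * X ^ s` is at most `(X + k) ^ (1 + s)`, and `X + k` is the base for `suc n`.
  cover-length : ∀ s n q → length (cover s n q) ≤ suc (k * n) ^ s
  cover-length zero    n       q = z≤n
  cover-length (suc s) zero    q = m^n>0 (suc (k * 0)) (suc s)
  cover-length (suc s) (suc n) q = begin
    length (ifAny cyclic? stay ++ concatMap leave (allFin k))
      ≡⟨ length-++ (ifAny cyclic? stay) ⟩
    length (ifAny cyclic? stay) + length (concatMap leave (allFin k))
      ≤⟨ +-mono-≤ (ifAny-length cyclic? stay stay≤)
                  (length-concatMap-≤ leave (X ^ s) (allFin k) (λ {a} _ → leave≤ a)) ⟩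
    X * X ^ s + length (allFin k) * X ^ s
      ≡⟨ cong (λ ℓ → X * X ^ s + ℓ * X ^ s) (length-tabulate {n = k} (λ a → a)) ⟩
    X * X ^ s + k * X ^ s
      ≡⟨ *-distribʳ-+ (X ^ s) X k ⟨
    (X + k) * X ^ s
      ≤⟨ *-monoʳ-≤ (X + k) (^-monoˡ-≤ s (m≤m+n X k)) ⟩
    (X + k) ^ suc s
      ≡⟨ cong (λ z → suc z ^ suc s) (trans (+-comm (k * n) k) (sym (*-suc k n))) ⟩
    suc (k * suc n) ^ suc s ∎
    where
    open ≤-Reasoning

    X : ℕ
    X = suc (k * n)

    cyclic? : Dec (∃[ a ] Cyclic q a)
    cyclic? = Fin.any? (λ a → reach? (δ q a) q)

    stay leave : Fin k → List (Expansion k)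
    stay  a = map (a ∷_) (cover (suc s) n (δ q a))
    leave a = map (a ∷_) (cover s n (δ q a))

    stay≤ : ∀ a → length (stay a) ≤ X ^ suc s
    stay≤ a = ≤-trans (≤-reflexive (length-map (a ∷_) (cover (suc s) n (δ q a)))) (cover-length (suc s) n (δ q a))

    leave≤ : ∀ a → length (leave a) ≤ X ^ s
    leave≤ a = ≤-trans (≤-reflexive (length-map (a ∷_) (cover s n (δ q a)))) (cover-length s n (δ q a))

  module _ (unbranched : ¬ Branching) where

    cyclic-unique : ∀ {q a b} → Reach start q → Coaccessible q → Cyclic q a → Cyclic q b → a ≡ b
    cyclic-unique {q} {a} {b} from to cyc cyc′ with Fin.<-cmp a b
    ... | tri< a<b _ _ = contradiction (q , from , to , a , b , a<b , cyc , cyc′) unbranched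
    ... | tri≈ _ a≡b _ = a≡b
    ... | tri> _ _ b<a = contradiction (q , from , to , b , a , b<a , cyc′ , cyc) unbranched

    ∈-ifAny : ∀ {q a w} (d : Dec (∃[ b ] Cyclic q b)) (f : Fin k → List (Expansion k)) →
              Reach start q → Coaccessible q → Cyclic q a → w List.∈ f a → w List.∈ ifAny d f
    ∈-ifAny (yes (b , cyc′)) f from to cyc w∈ = subst (λ c → _ List.∈ f c) (cyclic-unique from to cyc cyc′) w∈
    ∈-ifAny (no ¬cyc)        f from to cyc w∈ = contradiction (_ , cyc) ¬cyc

    -- `A` is any set containing the states reachable from `q`. A digit that stays in the component
    -- keeps `A`; after any other digit `q` is unreachable, so `A - q` still suffices and is
    -- smaller.
    cover-complete : ∀ s q w (A : Subset states) → Reach start q → (∀ {r} → Reach q r → r ∈ A) → ∣ A ∣ ≤ s →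
                     run q w ∈ final → w List.∈ cover s (length w) q
    -- The empty cover is harmless here: `q` reaches itself, so `A` cannot have size 0.
    cover-complete zero q w A from A⊇ A≤ acc =
      contradiction (<-≤-trans (x∈p⇒∣p-x∣<∣p∣ (A⊇ ([] , refl))) A≤) n≮0
    cover-complete (suc s) q []      A from A⊇ A≤ acc = here refl
    cover-complete (suc s) q (a ∷ w) A from A⊇ A≤ acc with reach? (δ q a) q
    ... | yes cyc = ∈-++⁺ˡ (∈-ifAny (Fin.any? _) _ from (_ , acc , a ∷ w , refl) cyc
          (∈-map⁺ (a ∷_) (cover-complete (suc s) (δ q a) w A
            (reach-trans from ([ a ] , refl)) (λ r → A⊇ (reach-trans ([ a ] , refl) r)) A≤ acc)))
    ... | no ¬cyc = ∈-++⁺ʳ (ifAny (Fin.any? (λ b → reach? (δ q b) q)) _)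
          (∈-concatMap⁺ (λ b → map (b ∷_) (cover s (length w) (δ q b))) (List.lose (∈-allFin a)
            (∈-map⁺ (a ∷_) (cover-complete s (δ q a) w (A - q)
              (reach-trans from ([ a ] , refl))
              (λ r → x∈p∧x≢y⇒x∈p-y (A⊇ (reach-trans ([ a ] , refl) r)) (λ { refl → ¬cyc r }))
              (s≤s⁻¹ (<-≤-trans (x∈p⇒∣p-x∣<∣p∣ (A⊇ ([] , refl))) A≤)) acc))))

-- A nonzero leading digit makes the value at least `k` to the number of remaining digits; the
-- successor accounts for the leading digit itself.
expansion-length : ∀ {k n} → 2 ≤ k → ∀ w → CanonicalExpansion {k} n w → length w ≤ suc ⌊log₂ n ⌋
expansion-length 2≤k [] can = z≤n
expansion-length {k} 2≤k (d ∷ w) (d≢0 , refl) = s≤s (begin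
  length w                            ≡⟨ ⌊log₂[2^n]⌋≡n (length w) ⟨
  ⌊log₂ 2 ^ length w ⌋                ≤⟨ ⌊log₂⌋-mono-≤ 2^w≤ ⟩
  ⌊log₂ value (d ∷ w) ⌋               ∎)
  where
  open ≤-Reasoning
  2^w≤ : 2 ^ length w ≤ value (d ∷ w)
  2^w≤ = begin
    2 ^ length w                      ≤⟨ ^-monoˡ-≤ (length w) 2≤k ⟩
    k ^ length w                      ≤⟨ m≤n*m (k ^ length w) (toℕ d) {{≢-nonZero d≢0}} ⟩
    toℕ d * k ^ length w              ≤⟨ m≤m+n _ (value w) ⟩
    toℕ d * k ^ length w + value w    ≡⟨ value-∷ d w ⟨
    value (d ∷ w)                     ∎

module _ {S : Pred ℕ 0ℓ} (S? : Decidable S) where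

  π-≤-length : ∀ {x ys} → (∀ {n} → n ≤ x → S n → n List.∈ ys) → π S? x ≤ length ys
  π-≤-length {x} covers = Unique-⊆⇒length≤ (filter⁺ S? (upTo⁺ (suc x)))
    (λ n∈ → let n∈upTo , n∈S = ∈-filter⁻ S? {xs = upTo (suc x)} n∈
            in covers (s≤s⁻¹ (∈-upTo⁻ n∈upTo)) n∈S)

module _ {k : ℕ} (2≤k : 2 ≤ k) {S : Pred ℕ 0ℓ} (S? : Decidable S) (M : DFA (Fin k))
  (L⇔M : ∀ w → canonicalLanguage k S w ⇔ Accepts M w) where

  open Automaton M
  open Covering M

  unbranched⇒sparse : ¬ Branching → Sparse S?
  -- One factor counts the word lengths and `states` factors come from `cover-length`. Each factor
  -- is at most `3 * k * L` once `L = ⌊log₂ x ⌋` is positive, whence the start at 2.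
  unbranched⇒sparse unbranched = suc states , (3 * k) ^ suc states , 2 , bound
    where
    covered : ∀ {x n} → n ≤ x → S n →
              n List.∈ concatMap (λ ℓ → map value (cover states ℓ start)) (upTo (2 + ⌊log₂ x ⌋))
    covered {x} {n} n≤x n∈S with canonicalExpansion 2≤k n
    ... | w , can@(_ , refl) = ∈-concatMap⁺ (λ ℓ → map value (cover states ℓ start)) (List.lose
      (∈-upTo⁺ (s≤s (≤-trans (expansion-length 2≤k w can) (s≤s (⌊log₂⌋-mono-≤ n≤x)))))
      (∈-map⁺ value (cover-complete unbranched states start w ⊤ ([] , refl) (λ _ → ∈⊤)
        (≤-reflexive (∣⊤∣≡n states)) (Equivalence.to (L⇔M w) (n , n∈S , can)))))

    bound : ∀ x → 2 ≤ x → π S? x ≤ (3 * k) ^ suc states * ⌊log₂ x ⌋ ^ suc states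
    bound x 2≤x = begin
      π S? x
        ≤⟨ π-≤-length S? covered ⟩
      length (concatMap (λ ℓ → map value (cover states ℓ start)) (upTo (2 + L)))
        ≤⟨ length-concatMap-≤ (λ ℓ → map value (cover states ℓ start)) (X ^ states) (upTo (2 + L)) each ⟩
      length (upTo (2 + L)) * X ^ states
        ≡⟨ cong (_* X ^ states) (length-upTo (2 + L)) ⟩
      (2 + L) * X ^ states
        ≤⟨ *-mono-≤ 2+L≤ (^-monoˡ-≤ states X≤) ⟩
      (3 * k * L) ^ suc states
        ≡⟨ ^-distribʳ-* (suc states) (3 * k) L ⟩
      (3 * k) ^ suc states * L ^ suc states ∎
      where
      open ≤-Reasoning hiding (start)
      L X : ℕ
      L = ⌊log₂ x ⌋
      X = suc (k * suc L)

      instance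
        k≢0 : NonZero k
        k≢0 = >-nonZero (≤-trans (s≤s z≤n) 2≤k)

        L≢0 : NonZero L
        L≢0 = >-nonZero (⌊log₂⌋-mono-≤ 2≤x)

      each : ∀ {ℓ} → ℓ List.∈ upTo (2 + L) → length (map value (cover states ℓ start)) ≤ X ^ states
      each {ℓ} ℓ∈ = begin
        length (map value (cover states ℓ start)) ≡⟨ length-map value (cover states ℓ start) ⟩
        length (cover states ℓ start)             ≤⟨ cover-length states ℓ start ⟩
        suc (k * ℓ) ^ states ≤⟨ ^-monoˡ-≤ states (s≤s (*-monoʳ-≤ k (s≤s⁻¹ (∈-upTo⁻ ℓ∈)))) ⟩
        X ^ states                                ∎

      X≤ : X ≤ 3 * k * L
      X≤ = begin
        1 + k * suc L           ≡⟨ cong suc (*-suc k L) ⟩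
        1 + (k + k * L)         ≤⟨ +-mono-≤ (m<n⇒0<n (<-≤-trans 2≤k (m≤m*n k L))) (+-monoˡ-≤ (k * L) (m≤m*n k L)) ⟩
        k * L + (k * L + k * L) ≡⟨ rearrange k L ⟩
        3 * k * L               ∎
        where
        rearrange : ∀ k L → k * L + (k * L + k * L) ≡ 3 * k * L
        rearrange = solve-∀

      2+L≤ : 2 + L ≤ 3 * k * L
      2+L≤ = ≤-trans (s≤s (m≤n*m (suc L) k)) X≤

-- Counting the sums of boundedly many members

-- Offering 0 as an extra choice at each of the `j` places accommodates shorter sums.
sumsUpTo : ℕ → List ℕ → List ℕ
sumsUpTo zero    es = [ 0 ]
sumsUpTo (suc j) es = cartesianProductWith _+_ (0 ∷ es) (sumsUpTo j es)

length-sumsUpTo : ∀ j es → length (sumsUpTo j es) ≡ suc (length es) ^ j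
length-sumsUpTo zero    es = refl
length-sumsUpTo (suc j) es = trans (length-cartesianProductWith _+_ (0 ∷ es) (sumsUpTo j es))
                                   (cong (suc (length es) *_) (length-sumsUpTo j es))

∈-sumsUpTo : ∀ {j es} xs → length xs ≤ j → All (List._∈ es) xs → sum xs List.∈ sumsUpTo j es
∈-sumsUpTo {zero}       [] _     _          = here refl
∈-sumsUpTo {suc j} {es} [] _     _          =
  ∈-cartesianProductWith⁺ _+_ {xs = 0 ∷ es} (here refl) (∈-sumsUpTo {j} [] z≤n [])
∈-sumsUpTo {suc j} {es} (x ∷ xs) (s≤s ≤j) (x∈ ∷ xs∈) =
  ∈-cartesianProductWith⁺ _+_ {xs = 0 ∷ es} (there x∈) (∈-sumsUpTo xs ≤j xs∈)

summands≤sum : ∀ xs → All (_≤ sum xs) xs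
summands≤sum []       = []
summands≤sum (x ∷ xs) = m≤m+n x (sum xs) ∷ All.map (λ y≤ → ≤-trans y≤ (m≤n+m (sum xs) x)) (summands≤sum xs)

module _ {S : Pred ℕ 0ℓ} (j : ℕ)
  (represent : ∀ n → ∃[ xs ] (length xs ≤ j × All S xs × sum xs ≡ n)) where

  -- The summands of any `n ≤ x` are themselves at most `x`. So all of `0` to `x` appear among the
  -- sums formed from the members counted by `π`.
  basis-count : (S? : Decidable S) → ∀ x → suc x ≤ suc (π S? x) ^ j
  basis-count S? x = begin
    suc x                      ≡⟨ length-upTo (suc x) ⟨
    length (upTo (suc x))      ≤⟨ Unique-⊆⇒length≤ (upTo⁺ (suc x)) (λ n∈ → covered (s≤s⁻¹ (∈-upTo⁻ n∈))) ⟩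
    length (sumsUpTo j es)     ≡⟨ length-sumsUpTo j es ⟩
    suc (π S? x) ^ j           ∎
    where
    open ≤-Reasoning
    es : List ℕ
    es = filter S? (upTo (suc x))

    covered : ∀ {n} → n ≤ x → n List.∈ sumsUpTo j es
    covered {n} n≤x with represent n
    ... | xs , ≤j , xs∈S , refl = ∈-sumsUpTo xs ≤j
      (All.zipWith (λ (y≤ , y∈S) → ∈-filter⁺ S? (∈-upTo⁺ (s≤s (≤-trans y≤ n≤x))) y∈S) (summands≤sum xs , xs∈S))

  -- Sparseness and `basis-count` together would bound `2 ^ t` by an expression linear in `t`, which
  -- fails for large `t`.
  basis⇒¬sparse : (S? : Decidable S) → ¬ Sparse S?
  basis⇒¬sparse S? (d , C , x₀ , bound) = contradiction exponents (<⇒≱ r*r<)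
    where
    open ≤-Reasoning

    -- The count is compared at x = 2^2^t, where (log x)^d = 2^(t d).
    r t x : ℕ
    r = suc ((C + 2 * d) * j + x₀)
    t = r + r
    x = 2 ^ (2 ^ t)

    log : ⌊log₂ x ⌋ ≡ 2 ^ t
    log = ⌊log₂[2^n]⌋≡n (2 ^ t)

    x₀≤x : x₀ ≤ x
    x₀≤x = begin
      x₀    ≤⟨ m≤n+m x₀ ((C + 2 * d) * j) ⟩
      _     ≤⟨ n≤1+n _ ⟩
      r     ≤⟨ m≤m+n r r ⟩
      t     ≤⟨ <⇒≤ (n<b^n (s≤s (s≤s z≤n)) t) ⟩
      2 ^ t ≤⟨ <⇒≤ (n<b^n (s≤s (s≤s z≤n)) (2 ^ t)) ⟩
      x     ∎

    π≤ : suc (π S? x) ≤ 2 ^ (C + t * d)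
    π≤ = begin
      suc (π S? x)                ≤⟨ s≤s (bound x x₀≤x) ⟩
      suc (C * ⌊log₂ x ⌋ ^ d)     ≡⟨ cong (λ z → suc (C * z ^ d)) log ⟩
      suc (C * (2 ^ t) ^ d)       ≡⟨ cong (λ z → suc (C * z)) (^-*-assoc 2 t d) ⟩
      1 + C * 2 ^ (t * d)         ≤⟨ +-monoˡ-≤ _ (m^n>0 2 (t * d)) ⟩
      suc C * 2 ^ (t * d)         ≤⟨ *-monoˡ-≤ (2 ^ (t * d)) (n<b^n (s≤s (s≤s z≤n)) C) ⟩
      2 ^ C * 2 ^ (t * d)         ≡⟨ ^-distribˡ-+-* 2 C (t * d) ⟨
      2 ^ (C + t * d)             ∎

    exponents : 2 ^ t ≤ (C + t * d) * j
    exponents = ≮⇒≥ λ lt → <⇒≱ (begin-strict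
      2 ^ ((C + t * d) * j)   <⟨ ^-monoʳ-< 2 (s≤s (s≤s z≤n)) lt ⟩
      x                       <⟨ n<1+n x ⟩
      suc x                   ≤⟨ basis-count S? x ⟩
      suc (π S? x) ^ j        ≤⟨ ^-monoˡ-≤ j π≤ ⟩
      (2 ^ (C + t * d)) ^ j   ∎) (≤-reflexive (^-*-assoc 2 (C + t * d) j))

    -- Taking `t = r + r` makes `2 ^ t` the square of `2 ^ r`, hence larger than `r * r`. The left
    -- side is at most `r * r` because `r` exceeds `(C + 2 * d) * j`.
    r*r< : (C + t * d) * j < 2 ^ t
    r*r< = begin-strict
      (C + (r + r) * d) * j          ≤⟨ *-monoˡ-≤ j (+-monoˡ-≤ _ (m≤n*m C r)) ⟩
      (r * C + (r + r) * d) * j      ≡⟨ rearrange r C d j ⟩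
      r * ((C + 2 * d) * j)          ≤⟨ *-monoʳ-≤ r (≤-trans (m≤m+n _ x₀) (n≤1+n _)) ⟩
      r * r                          <⟨ *-mono-< (n<b^n (s≤s (s≤s z≤n)) r) (n<b^n (s≤s (s≤s z≤n)) r) ⟩
      2 ^ r * 2 ^ r                  ≡⟨ ^-distribˡ-+-* 2 r r ⟨
      2 ^ t                          ∎
      where
      rearrange : ∀ r C d j → (r * C + (r + r) * d) * j ≡ r * ((C + 2 * d) * j)
      rearrange = solve-∀

  -- In a sum equal to 1, the first nonzero summand must be 1 itself.
  basis⇒1∈ : S 1
  basis⇒1∈ with represent 1
  ... | xs , _ , xs∈S , eq = unit xs xs∈S eq
    where
    unit : ∀ xs → All S xs → sum xs ≡ 1 → S 1
    unit (0           ∷ xs) (_ ∷ xs∈S) eq   = unit xs xs∈S eq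
    unit (1           ∷ xs) (p ∷ xs∈S) eq   = p

mainTheorem4 : (k : ℕ) (2≤k : 2 ≤ k) (S : Pred ℕ 0ℓ) (aut : Automatic k S) →
    (AdditiveBasis S → S 1)
    × (¬ Sparse (automatic⇒decidable 2≤k aut) × IsGCD S 1 × S 1 → AdditiveBasis S)
    × (AdditiveBasis S → ¬ Sparse (automatic⇒decidable 2≤k aut) × IsGCD S 1 × S 1)
mainTheorem4 k 2≤k S aut@(M , L⇔M) =
  (λ (j , represent) → basis⇒1∈ j represent) , sufficient , necessary
  where
  S? : Decidable S
  S? = automatic⇒decidable 2≤k aut

  sufficient : ¬ Sparse S? × IsGCD S 1 × S 1 → AdditiveBasis S
  sufficient (¬sparse , _ , 1∈S) with Automaton.branching? M
  ... | yes br = branching⇒basis 2≤k 1∈S M L⇔M br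
  ... | no ¬br = contradiction (unbranched⇒sparse 2≤k S? M L⇔M ¬br) ¬sparse

  necessary : AdditiveBasis S → ¬ Sparse S? × IsGCD S 1 × S 1
  necessary (j , represent) = basis⇒¬sparse j represent S? , ((λ n _ → 1∣ n) , λ c c∣ → c∣ 1 1∈S) , 1∈S
    where
    1∈S : S 1
    1∈S = basis⇒1∈ j represent
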